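{- If $m$ is a prime, then for every integer $g\geq m-1$ the number $i_g(m)$ of numerical semigroups of genus $g$ and multiplicity $m$ that are in an infinite chain is $1$.
   Context: A numerical semigroup is a subset $\Lambda\subseteq\mathbb{N}_0=\{0,1,2,\dots\}$ containing $0$, closed under addition, with finite complement in $\mathbb{N}_0$. Its genus is the cardinality of the complement. Its multiplicity is its smallest non-zero element. Its conductor $c(\Lambda)$ is the smallest $c\in\mathbb{N}_0$ with $\{\ell\in\mathbb{N}_0:\ell\ge c\}\subseteq\Lambda$. The effective generators of $\Lambda$ are the minimal generators of $\Lambda$ that are at least $c(\Lambda)$. The children of $\Lambda$ are the numerical semigroups $\Lambda\setminus\{a\}$ with $a$ an effective generator of $\Lambda$; $\Lambda$ is then the parent of each of these. An infinite chain is an infinite sequence of numerical semigroups $\Lambda_0,\Lambda_1,\Lambda_2,\dots$ such that $\Lambda_0=\mathbb{N}_0$ and $\Lambda_i$ is the parent of $\Lambda_{i+1}$ for all $i\ge 0$; a numerical semigroup is in the chain if it is one of the $\Lambda_i$. -}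

module Defs where

open import Data.Fin using (Fin)
open import Data.Nat using (ℕ; suc; _+_; _≤_)
open import Data.Product using (Σ; ∃; _×_; proj₁)
open import Function.Bundles using (Inverse)
open import Level using (0ℓ; _⊔_) renaming (suc to lsuc)
open import Relation.Binary.Bundles using (Setoid)
open import Relation.Binary.PropositionalEquality using (_≡_; _≢_; setoid)
open import Relation.Unary using (Pred; Decidable; _∈_; _⊆_; _≐_; U; ∁; _∖_; ｛_｝)
open import Relation.Unary.Relation.Binary.Equality using (≐-setoid)
import Relation.Binary.Construct.On as On

-- The elements of S satisfying P, compared by the equality of S alone
-- (the proofs of P are irrelevant), correspond bijectively to Fin n.
HasCardinality : ∀ {a ℓ p} (S : Setoid a ℓ) → Pred (Setoid.Carrier S) p → ℕ →
                 Set (a ⊔ ℓ ⊔ p)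
HasCardinality S P n =
  Inverse (setoid (Fin n)) (On.setoid {B = Σ (Setoid.Carrier S) P} S proj₁)

IsLeast : ∀ {p} → Pred ℕ p → Pred ℕ p
IsLeast P n = P n × (∀ k → P k → n ≤ k)

-- Classically `decidable` is automatic; constructively it makes precise that
-- the semigroup is determined by its (finite) set of gaps.
record NumericalSemigroup : Set₁ where
  field
    carrier          : Pred ℕ 0ℓ
    decidable        : Decidable carrier
    0∈               : 0 ∈ carrier
    +-closed         : ∀ {x y} → x ∈ carrier → y ∈ carrier → x + y ∈ carrier
    finiteComplement : ∃ λ n → HasCardinality (setoid ℕ) (∁ carrier) n

  genus : ℕ
  genus = proj₁ finiteComplement

open NumericalSemigroup public

-- Semigroups are identified when they have the same elements.
numericalSemigroupSetoid : Setoid (lsuc 0ℓ) 0ℓ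
numericalSemigroupSetoid = On.setoid (≐-setoid ℕ 0ℓ) carrier

IsMultiplicity : NumericalSemigroup → ℕ → Set
IsMultiplicity Λ = IsLeast (λ x → x ∈ carrier Λ × x ≢ 0)

IsConductor : NumericalSemigroup → ℕ → Set
IsConductor Λ = IsLeast (λ c → ∀ ℓ → c ≤ ℓ → ℓ ∈ carrier Λ)

-- The submonoid of (ℕ, +, 0) generated by A.
data ⟨_⟩ (A : Pred ℕ 0ℓ) : Pred ℕ 0ℓ where
  gen  : ∀ {x} → x ∈ A → x ∈ ⟨ A ⟩
  zero : 0 ∈ ⟨ A ⟩
  plus : ∀ {x y} → x ∈ ⟨ A ⟩ → y ∈ ⟨ A ⟩ → x + y ∈ ⟨ A ⟩

_Generates_ : Pred ℕ 0ℓ → NumericalSemigroup → Set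
A Generates Λ = ⟨ A ⟩ ≐ carrier Λ

IsMinimalGeneratingSet : NumericalSemigroup → Pred ℕ 0ℓ → Set₁
IsMinimalGeneratingSet Λ A =
  A Generates Λ × (∀ (B : Pred ℕ 0ℓ) → B ⊆ A → B Generates Λ → A ⊆ B)

-- A numerical semigroup has exactly one minimal generating set, so "some" and
-- "the" minimal generating set agree here.
IsMinimalGenerator : NumericalSemigroup → ℕ → Set₁
IsMinimalGenerator Λ a = ∃ λ A → IsMinimalGeneratingSet Λ A × a ∈ A

IsEffectiveGenerator : NumericalSemigroup → ℕ → Set₁
IsEffectiveGenerator Λ a =
  IsMinimalGenerator Λ a × (∃ λ c → IsConductor Λ c × c ≤ a)

_IsParentOf_ : NumericalSemigroup → NumericalSemigroup → Set₁
Λ IsParentOf Λ′ =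
  ∃ λ a → IsEffectiveGenerator Λ a × carrier Λ′ ≐ carrier Λ ∖ ｛ a ｝

IsInfiniteChain : (ℕ → NumericalSemigroup) → Set₁
IsInfiniteChain Λ = carrier (Λ 0) ≐ U {A = ℕ} × (∀ i → Λ i IsParentOf Λ (suc i))

InSomeInfiniteChain : NumericalSemigroup → Set₁
InSomeInfiniteChain Λ =
  ∃ λ chain → IsInfiniteChain chain × (∃ λ i → carrier (chain i) ≐ carrier Λ)

-- i[ g , m ]≡ n  says that n is the number i_g(m) of numerical semigroups of
-- genus g and multiplicity m that are in an infinite chain.
i[_,_]≡_ : ℕ → ℕ → ℕ → Set₁
i[ g , m ]≡ n = HasCardinality numericalSemigroupSetoid
  (λ Λ → genus Λ ≡ g × IsMultiplicity Λ m × InSomeInfiniteChain Λ) n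

{-# OPTIONS --safe #-}

-- Call the semigroup consisting of the multiples of m and of everything from a
-- bound on a truncated semigroup.  Removing the non-multiples of m one by one
-- from ℕ gives an infinite chain through exactly one truncated semigroup of
-- each genus, because a non-multiple of m is not a sum of multiples of m.
-- Conversely, the removed elements of an infinite chain increase, so an element
-- below the conductor of a member is never removed later.  If such an element
-- were coprime to the multiplicity m, then all large numbers would stay in the
-- chain forever; for m prime, the member is therefore truncated.
module Submission where

open import Defs
open import Data.Empty using (⊥-elim)
open import Data.Fin using (Fin; zero; suc; toℕ; fromℕ<)
open import Data.Fin.Properties
  using (toℕ<n; toℕ-fromℕ<; toℕ-injective; injective⇒≤)
open import Data.Nat
open import Data.Nat.Coprimality using (Coprime; coprime-Bézout)
open import Data.Nat.Divisibility
open import Data.Nat.DivMod using (_/_; _%_; m≡m%n+[m/n]*n; m%n<n)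
open import Data.Nat.GCD using (module Bézout)
open import Data.Nat.Induction using (<-rec)
open import Data.Nat.Primality
  using (Prime; prime⇒irreducible; prime⇒nonTrivial)
open import Data.Nat.Properties
open import Data.Nat.Tactic.RingSolver using (solve-∀)
open import Data.Product using (∃; _×_; _,_; proj₁; proj₂)
open import Data.Sum using (_⊎_; inj₁; inj₂; [_,_]; map₂)
open import Function using (_∘_; Inverse)
open import Function.Properties.Bijection using (Bijection⇒Inverse)
open import Level using (0ℓ)
open import Relation.Binary.Bundles using (Setoid)
open import Relation.Binary.PropositionalEquality hiding ([_])
open import Relation.Nullary using (¬_; Dec; yes; no; contradiction)
open import Relation.Nullary.Decidable
  using (decidable-stable; ¬?; _×-dec_; _⊎-dec_)
open import Relation.Unary using (Pred; Decidable; _∈_; _∉_; _⊆_; _≐_; ∁)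

-- Counting finite sets.

enumeration⇒cardinality :
  ∀ {a ℓ p} (S : Setoid a ℓ) {P : Pred (Setoid.Carrier S) p} {n}
  (f : Fin n → Setoid.Carrier S) → (∀ i → f i ∈ P) →
  (∀ {i j} → Setoid._≈_ S (f i) (f j) → i ≡ j) →
  (∀ {x} → x ∈ P → ∃ λ i → Setoid._≈_ S (f i) x) →
  HasCardinality S P n
enumeration⇒cardinality S f f∈ f-inj f-surj = Bijection⇒Inverse record
  { to        = λ i → f i , f∈ i
  ; cong      = λ { refl → Setoid.refl S }
  ; bijective = f-inj
              , λ (_ , x∈) → proj₁ (f-surj x∈) , λ { refl → proj₂ (f-surj x∈) }
  }

-- Placing `x` in front of the enumeration of `P` would inject `Fin (suc n)` into `Fin n`.
⊆-cardinality-≡⇒¬∉ :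
  ∀ {P Q : Pred ℕ 0ℓ} {n} → HasCardinality (setoid ℕ) P n →
  HasCardinality (setoid ℕ) Q n → P ⊆ Q → ∀ {x} → x ∈ Q → ¬ x ∉ P
⊆-cardinality-≡⇒¬∉ {P} {Q} {n} P↔ Q↔ P⊆Q {x} x∈Q x∉P =
  1+n≰n (injective⇒≤ index-injective)
  where
  module P↔ = Inverse P↔
  module Q↔ = Inverse Q↔

  element : Fin (suc n) → ∃ Q
  element zero    = x , x∈Q
  element (suc i) = proj₁ (P↔.to i) , P⊆Q (proj₂ (P↔.to i))

  element-injective : ∀ i j → proj₁ (element i) ≡ proj₁ (element j) → i ≡ j
  element-injective zero    zero    _  = refl
  element-injective zero    (suc j) eq =
    contradiction (subst P (sym eq) (proj₂ (P↔.to j))) x∉P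
  element-injective (suc i) zero    eq =
    contradiction (subst P eq (proj₂ (P↔.to i))) x∉P
  element-injective (suc i) (suc j) eq = cong suc
    (trans (sym (P↔.inverseʳ refl)) (P↔.inverseʳ {y = P↔.to i} eq))

  index-injective : ∀ {i j} → Q↔.from (element i) ≡ Q↔.from (element j) → i ≡ j
  index-injective {i} {j} eq = element-injective i j
    (trans (sym (Q↔.inverseˡ {x = element i} refl)) (Q↔.inverseˡ {x = element j} eq))

-- Minimal generators, and generation by coprime elements.

module _ (Λ : NumericalSemigroup) where

  *-closed : ∀ k {x} → x ∈ carrier Λ → k * x ∈ carrier Λ
  *-closed zero    _  = 0∈ Λ
  *-closed (suc k) x∈ = +-closed Λ x∈ (*-closed k x∈)

  ∣-closed : ∀ {x y} → x ∈ carrier Λ → x ∣ y → y ∈ carrier Λ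
  ∣-closed x∈ (divides-refl k) = *-closed k x∈

  -- The bound `y < x` makes `x ∸ y` a genuine nonzero summand and the search for `y` finite.
  Decomposable : Pred ℕ 0ℓ
  Decomposable x = ∃ λ y → y < x × y ≢ 0 × y ∈ carrier Λ × x ∸ y ∈ carrier Λ

  Irreducible : Pred ℕ 0ℓ
  Irreducible x = x ∈ carrier Λ × x ≢ 0 × ¬ Decomposable x

  decomposable? : Decidable Decomposable
  decomposable? x = anyUpTo?
    (λ y → ¬? (y ≟ 0) ×-dec decidable Λ y ×-dec decidable Λ (x ∸ y)) x

  irreducible-generates : Irreducible Generates Λ
  irreducible-generates = to , <-rec (λ x → x ∈ carrier Λ → x ∈ ⟨ Irreducible ⟩) from _
    where
    to : ∀ {x} → x ∈ ⟨ Irreducible ⟩ → x ∈ carrier Λ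
    to (gen (x∈ , _)) = x∈
    to zero           = 0∈ Λ
    to (plus y∈ z∈)   = +-closed Λ (to y∈) (to z∈)

    from : ∀ x → (∀ {y} → y < x → y ∈ carrier Λ → y ∈ ⟨ Irreducible ⟩) →
           x ∈ carrier Λ → x ∈ ⟨ Irreducible ⟩
    from x rec x∈ with x ≟ 0 | decomposable? x
    ... | yes refl | _      = zero
    ... | no x≢0   | no x∉D = gen (x∈ , x≢0 , x∉D)
    ... | no _     | yes (y , y<x , y≢0 , y∈ , x∸y∈) =
      subst ⟨ Irreducible ⟩ (m+[n∸m]≡n (<⇒≤ y<x))
        (plus (rec y<x y∈)
              (rec (∸-monoʳ-< (n≢0⇒n>0 y≢0) (<⇒≤ y<x)) x∸y∈))

  -- A derivation of an irreducible element can use `plus` only with a zero summand, so it descends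
  -- to a `gen`.
  irreducible⊆generators : ∀ {B} → B Generates Λ → Irreducible ⊆ B
  irreducible⊆generators {B} (B⊆Λ , Λ⊆B) irr@(x∈ , _) = go (Λ⊆B x∈) irr
    where
    go : ∀ {x} → x ∈ ⟨ B ⟩ → Irreducible x → x ∈ B
    go (gen x∈B) _ = x∈B
    go zero (_ , 0≢0 , _) = contradiction refl 0≢0
    go (plus {zero} _ z∈) irr = go z∈ irr
    go (plus {suc y} {zero} y∈ _) irr =
      subst B (sym (+-identityʳ _))
        (go y∈ (subst Irreducible (+-identityʳ (suc y)) irr))
    go (plus {y@(suc _)} {z@(suc _)} y∈ z∈) (_ , _ , x∉D) = contradiction
      (y , m<m+n y z<s , (λ ()) , B⊆Λ y∈ ,
       subst (carrier Λ) (sym (m+n∸m≡n y z)) (B⊆Λ z∈)) x∉D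

  irreducible⇒minimalGenerator : ∀ {x} → Irreducible x → IsMinimalGenerator Λ x
  irreducible⇒minimalGenerator irr =
    Irreducible
    , (irreducible-generates , λ B _ B-gen → irreducible⊆generators B-gen)
    , irr

  -- Write y = q e + r with r < e ≤ q, so that y = (q ∸ r) e + r (e + 1).
  consecutive⇒cofinite :
    ∀ e → e ∈ carrier Λ → suc e ∈ carrier Λ → ∀ {y} → e * e ≤ y → y ∈ carrier Λ
  consecutive⇒cofinite zero _ 1∈ {y} _ = ∣-closed 1∈ (1∣ y)
  consecutive⇒cofinite e@(suc _) e∈ 1+e∈ {y} e²≤y =
    subst (carrier Λ) (sym y≡) (+-closed Λ (*-closed d e∈) (*-closed r 1+e∈))
    where
    q = y / e
    r = y % e

    r≤q : r ≤ q
    r≤q = ≮⇒≥ λ q<r → <⇒≱ (y<e² q<r) e²≤y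
      where
      open ≤-Reasoning

      y<e² : q < r → y < e * e
      y<e² q<r = begin-strict
        y          ≡⟨ m≡m%n+[m/n]*n y e ⟩
        r + q * e  <⟨ +-monoˡ-< (q * e) (m%n<n y e) ⟩
        suc q * e  ≤⟨ *-monoˡ-≤ e (≤-trans q<r (<⇒≤ (m%n<n y e))) ⟩
        e * e      ∎

    d = q ∸ r

    regroup : ∀ d e r → r + (r + d) * e ≡ d * e + r * suc e
    regroup = solve-∀

    y≡ : y ≡ d * e + r * suc e
    y≡ = begin
      y                    ≡⟨ m≡m%n+[m/n]*n y e ⟩
      r + q * e            ≡⟨ cong (λ t → r + t * e) (m+[n∸m]≡n r≤q) ⟨
      r + (r + d) * e      ≡⟨ regroup d e r ⟩
      d * e + r * suc e    ∎
      where open ≡-Reasoning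

-- A Bézout identity makes a multiple of one number the successor of a multiple of the other. The
-- bound `N` is chosen before `Λ`, so it serves all members of a chain at once.
coprime⇒cofinite :
  ∀ {m n} → Coprime m n → ∃ λ N → ∀ Λ → m ∈ carrier Λ → n ∈ carrier Λ →
  ∀ {y} → N ≤ y → y ∈ carrier Λ
coprime⇒cofinite coprime with coprime-Bézout coprime
... | Bézout.+- x y eq = _ , λ Λ m∈ n∈ → consecutive⇒cofinite Λ _
  (*-closed Λ y n∈) (subst (carrier Λ) (sym eq) (*-closed Λ x m∈))
... | Bézout.-+ x y eq = _ , λ Λ m∈ n∈ → consecutive⇒cofinite Λ _
  (*-closed Λ x m∈) (subst (carrier Λ) (sym eq) (*-closed Λ y n∈))

-- Infinite chains.

module _ (chain : ℕ → NumericalSemigroup)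
         (parent : ∀ i → chain i IsParentOf chain (suc i)) where

  removed : ℕ → ℕ
  removed i = proj₁ (parent i)

  removed-∉ : ∀ i → removed i ∉ carrier (chain (suc i))
  removed-∉ i ∈suc = proj₂ (proj₁ (proj₂ (proj₂ (parent i))) ∈suc) refl

  ≥removed⇒∈ : ∀ i {x} → removed i ≤ x → x ∈ carrier (chain i)
  ≥removed⇒∈ i r≤x with parent i
  ... | _ , (_ , _ , (c≤⇒∈ , _) , c≤r) , _ = c≤⇒∈ _ (≤-trans c≤r r≤x)

  removed-increasing : ∀ i → removed i < removed (suc i)
  removed-increasing i = ≰⇒> (removed-∉ i ∘ ≥removed⇒∈ (suc i))

  ≤-removed : ∀ i → i ≤ removed i
  ≤-removed zero    = z≤n
  ≤-removed (suc i) = ≤-<-trans (≤-removed i) (removed-increasing i)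

  -- Later removals only take larger elements; the bound on `x` is carried along for the induction.
  <removed⇒permanent : ∀ n {i x} → x ∈ carrier (chain i) → x < removed i →
    x ∈ carrier (chain (n + i)) × x < removed (n + i)
  <removed⇒permanent zero    x∈ x< = x∈ , x<
  <removed⇒permanent (suc n) {i} x∈ x< with <removed⇒permanent n x∈ x<
  ... | x∈′ , x<′ =
    proj₂ (proj₂ (proj₂ (parent (n + i)))) (x∈′ , <⇒≢ x<′ ∘ sym)
    , <-trans x<′ (removed-increasing (n + i))

  -- Otherwise both elements would force all numbers from some `N` on into every later member,
  -- although ever larger numbers are removed.
  permanent⇒¬coprime : ∀ {i m x} → m ∈ carrier (chain i) → m < removed i →
    x ∈ carrier (chain i) → x < removed i → ¬ Coprime m x
  permanent⇒¬coprime {i} m∈ m< x∈ x< coprime with coprime⇒cofinite coprime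
  -- The index `N + i` guarantees `N ≤ removed (N + i)`; that number is missing one member later.
  ... | N , cofinite = removed-∉ (N + i)
    (cofinite (chain (suc N + i))
      (proj₁ (<removed⇒permanent (suc N) m∈ m<))
      (proj₁ (<removed⇒permanent (suc N) x∈ x<))
      (≤-trans (m≤m+n N i) (≤-removed (N + i))))

prime∤⇒coprime : ∀ {p n} → Prime p → ¬ p ∣ n → Coprime p n
prime∤⇒coprime pr p∤n (d∣p , d∣n) with prime⇒irreducible pr d∣p
... | inj₁ d≡1  = d≡1
... | inj₂ refl = contradiction d∣n p∤n

-- Truncated semigroups.

Truncated : ℕ → ℕ → Pred ℕ 0ℓ
Truncated m b x = m ∣ x ⊎ b ≤ x

-- The bound is the element removed next: everything from it on is present, and below it
-- `permanent⇒¬coprime` leaves only multiples of the prime `m`.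
inChain⇒truncated :
  ∀ {m} → Prime m → ∀ Λ → IsMultiplicity Λ m → InSomeInfiniteChain Λ →
  ∃ λ b → carrier Λ ≐ Truncated m b
inChain⇒truncated {m} pr Λ ((m∈ , _) , least)
  (chain , (_ , parent) , i , chain⊆ , chain⊇) = b , to , from
  where
  b = removed chain parent i

  to : carrier Λ ⊆ Truncated m b
  to {x} x∈ with m ∣? x | b ≤? x
  ... | yes m∣x | _       = inj₁ m∣x
  ... | no _    | yes b≤x = inj₂ b≤x
  ... | no m∤x  | no b≰x  = ⊥-elim
    (permanent⇒¬coprime chain parent (chain⊇ m∈) (≤-<-trans m≤x x<b) (chain⊇ x∈) x<b
      (prime∤⇒coprime pr m∤x))
    where
    x<b = ≰⇒> b≰x
    -- Minimality of `m` puts `m` below `b` too, so that `m` is also permanent.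
    m≤x = least x (x∈ , λ { refl → m∤x (m ∣0) })

  from : Truncated m b ⊆ carrier Λ
  from (inj₁ m∣x) = ∣-closed Λ m∈ m∣x
  from (inj₂ b≤x) = chain⊆ (≥removed⇒∈ chain parent i b≤x)

truncated? : ∀ m b → Decidable (Truncated m b)
truncated? m b x = (m ∣? x) ⊎-dec (b ≤? x)

truncated-antitone : ∀ m {b c} → b ≤ c → Truncated m c ⊆ Truncated m b
truncated-antitone m b≤c = map₂ (≤-trans b≤c)

truncated-+-closed : ∀ m b {x y} →
  x ∈ Truncated m b → y ∈ Truncated m b → x + y ∈ Truncated m b
truncated-+-closed m b (inj₁ m∣x) (inj₁ m∣y) = inj₁ (∣m∣n⇒∣m+n m∣x m∣y)
truncated-+-closed m b {x} {y} (inj₂ b≤x) _  = inj₂ (≤-trans b≤x (m≤m+n x y))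
truncated-+-closed m b {x} {y} _ (inj₂ b≤y)  = inj₂ (≤-trans b≤y (m≤n+m y x))

-- If `b ≤ c`, the gaps for `b` are among those for `c`; being equally many, they coincide.
truncated-cardinality⇒⊆ : ∀ {m b c n} →
  HasCardinality (setoid ℕ) (∁ (Truncated m b)) n →
  HasCardinality (setoid ℕ) (∁ (Truncated m c)) n →
  Truncated m b ⊆ Truncated m c
truncated-cardinality⇒⊆ {m} {b} {c} ∁b ∁c {x} x∈b with ≤-total c b
... | inj₁ c≤b = truncated-antitone m c≤b x∈b
... | inj₂ b≤c = decidable-stable (truncated? m c x) λ x∉c →
  ⊆-cardinality-≡⇒¬∉ ∁b ∁c (λ y∉b → y∉b ∘ truncated-antitone m b≤c) x∉c
    (λ x∉b → x∉b x∈b)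

cardinality-∁-resp-≐ : ∀ {P Q : Pred ℕ 0ℓ} {n} → P ≐ Q →
  HasCardinality (setoid ℕ) (∁ P) n → HasCardinality (setoid ℕ) (∁ Q) n
cardinality-∁-resp-≐ (P⊆Q , Q⊆P) ∁P = enumeration⇒cardinality (setoid ℕ)
  (proj₁ ∘ to) (λ i → proj₂ (to i) ∘ Q⊆P)
  (λ {i} eq → trans (sym (inverseʳ refl)) (inverseʳ {y = to i} eq))
  (λ x∉Q → from (_ , x∉Q ∘ P⊆Q) , inverseˡ refl)
  where open Inverse ∁P

-- The chain of truncated semigroups.

module _ (m : ℕ) .{{_ : NonTrivial m}} where

  -- Skipping one number suffices, since `m ≥ 2` cannot divide two consecutive numbers. The decision
  -- is an argument so that a later `with` on it unfolds `nonMultiple (suc i)`.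
  next : ∀ x → Dec (m ∣ suc x) → ℕ
  next x (yes _) = 2 + x
  next x (no _)  = 1 + x

  -- The i-th non-multiple of m, counted from 0.
  nonMultiple : ℕ → ℕ
  nonMultiple zero    = 1
  nonMultiple (suc i) = next (nonMultiple i) (m ∣? suc (nonMultiple i))

  m∤1 : ¬ m ∣ 1
  m∤1 m∣1 = nonTrivial⇒≢1 (∣1⇒≡1 m∣1)

  nonMultiple-∤ : ∀ i → ¬ m ∣ nonMultiple i
  nonMultiple-∤ zero = m∤1
  nonMultiple-∤ (suc i) with m ∣? suc (nonMultiple i)
  ... | no ∤1+  = ∤1+
  ... | yes ∣1+ = λ ∣2+ → m∤1
    (∣m+n∣m⇒∣n (subst (m ∣_) (+-comm 1 (suc (nonMultiple i))) ∣2+) ∣1+)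

  nonMultiple-increasing : ∀ i → nonMultiple i < nonMultiple (suc i)
  nonMultiple-increasing i with m ∣? suc (nonMultiple i)
  ... | no _  = ≤-refl
  ... | yes _ = m≤n⇒m≤1+n ≤-refl

  nonMultiple-mono-< : ∀ {i j} → i < j → nonMultiple i < nonMultiple j
  nonMultiple-mono-< {i} {suc j} i<1+j with m<1+n⇒m<n∨m≡n i<1+j
  ... | inj₁ i<j  = <-trans (nonMultiple-mono-< i<j) (nonMultiple-increasing j)
  ... | inj₂ refl = nonMultiple-increasing j

  nonMultiple-injective : ∀ {i j} → nonMultiple i ≡ nonMultiple j → i ≡ j
  nonMultiple-injective {i} {j} eq = ≤-antisym
    (≮⇒≥ λ j<i → <⇒≢ (nonMultiple-mono-< j<i) (sym eq))
    (≮⇒≥ λ i<j → <⇒≢ (nonMultiple-mono-< i<j) eq)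

  <-nonMultiple : ∀ i → i < nonMultiple i
  <-nonMultiple zero    = z<s
  <-nonMultiple (suc i) = ≤-<-trans (<-nonMultiple i) (nonMultiple-increasing i)

  -- Any number skipped between successive values of `nonMultiple` is a multiple of `m`.
  <nonMultiple-suc : ∀ i {x} → ¬ m ∣ x → x < nonMultiple (suc i) →
    x < nonMultiple i ⊎ x ≡ nonMultiple i
  <nonMultiple-suc i m∤x x< with m ∣? suc (nonMultiple i)
  ... | no _ = m<1+n⇒m<n∨m≡n x<
  ... | yes m∣ with m<1+n⇒m<n∨m≡n x<
  ...   | inj₁ x<′  = m<1+n⇒m<n∨m≡n x<′
  ...   | inj₂ refl = contradiction m∣ m∤x

  nonMultiple-surjective : ∀ n {x} → ¬ m ∣ x → x < nonMultiple n →
    ∃ λ i → i < n × nonMultiple i ≡ x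
  nonMultiple-surjective zero m∤x (s≤s z≤n) = contradiction (m ∣0) m∤x
  nonMultiple-surjective (suc n) m∤x x< with <nonMultiple-suc n m∤x x<
  ... | inj₂ refl = n , n<1+n n , refl
  ... | inj₁ x<n with nonMultiple-surjective n m∤x x<n
  ...   | i , i<n , eq = i , m<n⇒m<1+n i<n , eq

  -- As `nonMultiple` counts from 0, exactly `g` non-multiples lie below `nonMultiple g`.
  truncated-gaps : ∀ g →
    HasCardinality (setoid ℕ) (∁ (Truncated m (nonMultiple g))) g
  truncated-gaps g = enumeration⇒cardinality (setoid ℕ) (nonMultiple ∘ toℕ)
    (λ i → [ nonMultiple-∤ (toℕ i) , <⇒≱ (nonMultiple-mono-< (toℕ<n i)) ])
    (toℕ-injective ∘ nonMultiple-injective)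
    (λ x∉ → index (nonMultiple-surjective g (x∉ ∘ inj₁) (≰⇒> (x∉ ∘ inj₂))))
    where
    index : ∀ {x} → (∃ λ i → i < g × nonMultiple i ≡ x) →
            ∃ λ (j : Fin g) → nonMultiple (toℕ j) ≡ x
    index (i , i<g , eq) =
      fromℕ< i<g , trans (cong nonMultiple (toℕ-fromℕ< i<g)) eq

  truncatedSemigroup : ℕ → NumericalSemigroup
  truncatedSemigroup g = record
    { carrier          = Truncated m (nonMultiple g)
    ; decidable        = truncated? m (nonMultiple g)
    ; 0∈               = inj₁ (m ∣0)
    ; +-closed         = truncated-+-closed m (nonMultiple g)
    ; finiteComplement = g , truncated-gaps g
    }

  -- The bound on `g` gives `m ≤ nonMultiple g`, so no nonzero element lies below `m`.
  truncated-multiplicity : ∀ {g} → g ≥ m ∸ 1 →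
    IsMultiplicity (truncatedSemigroup g) m
  truncated-multiplicity {g} g≥ = (inj₁ ∣-refl , m≢0) , least
    where
    instance _ = nonTrivial⇒nonZero m
    m≢0 = ≢-nonZero⁻¹ m

    least : ∀ x → x ∈ Truncated m (nonMultiple g) × x ≢ 0 → m ≤ x
    least x (inj₁ m∣x , x≢0) = ∣⇒≤ {{≢-nonZero x≢0}} m∣x
    least x (inj₂ u≤x , _)   = begin
      m              ≡⟨ suc-pred m ⟨
      suc (m ∸ 1)    ≤⟨ s≤s g≥ ⟩
      suc g          ≤⟨ <-nonMultiple g ⟩
      nonMultiple g  ≤⟨ u≤x ⟩
      x              ∎
      where open ≤-Reasoning

  -- Two nonzero summands of `nonMultiple g` lie below the bound, so both would be multiples of `m`,
  -- and hence so would their sum.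
  nonMultiple-irreducible : ∀ g →
    Irreducible (truncatedSemigroup g) (nonMultiple g)
  nonMultiple-irreducible g =
    inj₂ ≤-refl , m<n⇒n≢0 (<-nonMultiple g) , indecomposable
    where
    u = nonMultiple g

    indecomposable : ¬ Decomposable (truncatedSemigroup g) u
    indecomposable (y , y<u , _ , inj₂ u≤y , _) = <⇒≱ y<u u≤y
    indecomposable (y , y<u , y≢0 , inj₁ _ , inj₂ u≤u∸y) =
      <⇒≱ (∸-monoʳ-< (n≢0⇒n>0 y≢0) (<⇒≤ y<u)) u≤u∸y
    indecomposable (y , y<u , _ , inj₁ m∣y , inj₁ m∣u∸y) = nonMultiple-∤ g
      (subst (m ∣_) (m+[n∸m]≡n (<⇒≤ y<u)) (∣m∣n⇒∣m+n m∣y m∣u∸y))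

  truncated-conductor : ∀ g →
    ∃ λ c → IsConductor (truncatedSemigroup g) c × c ≤ nonMultiple g
  -- The bound is 1 here, but 0 is a multiple of `m`, so the conductor drops to 0.
  truncated-conductor zero = 0 , (all∈ , λ _ _ → z≤n) , z≤n
    where
    all∈ : ∀ ℓ → 0 ≤ ℓ → ℓ ∈ Truncated m 1
    all∈ zero    _ = inj₁ (m ∣0)
    all∈ (suc _) _ = inj₂ (s≤s z≤n)
  truncated-conductor (suc g) =
    -- The conductor follows the largest gap `u`; it is less than `nonMultiple (suc g)` when a
    -- multiple of `m` lies between.
    suc u , (from-conductor , least) , nonMultiple-increasing g
    where
    u = nonMultiple g

    from-conductor : ∀ ℓ → u < ℓ → ℓ ∈ Truncated m (nonMultiple (suc g))
    from-conductor ℓ u<ℓ = decidable-stable (truncated? m _ ℓ) λ ℓ∉ →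
      [ <-asym u<ℓ , <⇒≢ u<ℓ ∘ sym ]
        (<nonMultiple-suc g (ℓ∉ ∘ inj₁) (≰⇒> (ℓ∉ ∘ inj₂)))

    least : ∀ k → (∀ ℓ → k ≤ ℓ → ℓ ∈ Truncated m (nonMultiple (suc g))) → u < k
    least k k≤⇒∈ = ≰⇒> λ k≤u →
      [ nonMultiple-∤ g , <⇒≱ (nonMultiple-increasing g) ] (k≤⇒∈ u k≤u)

  truncated-parent : ∀ g →
    truncatedSemigroup g IsParentOf truncatedSemigroup (suc g)
  truncated-parent g =
    u
    , (irreducible⇒minimalGenerator (truncatedSemigroup g)
         (nonMultiple-irreducible g)
      , truncated-conductor g)
    , (λ x∈ → truncated-antitone m (<⇒≤ (nonMultiple-increasing g)) x∈
            , λ { refl → [ nonMultiple-∤ g , <⇒≱ (nonMultiple-increasing g) ] x∈ })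
    -- A non-multiple below the new bound is `u` or lies below `u`; in the latter case it is not in
    -- the parent.
    , λ {x} (x∈ , u≢x) → decidable-stable (truncated? m _ x) λ x∉ →
        [ (λ x<u → [ x∉ ∘ inj₁ , <⇒≱ x<u ] x∈) , u≢x ∘ sym ]
          (<nonMultiple-suc g (x∉ ∘ inj₁) (≰⇒> (x∉ ∘ inj₂)))
    where u = nonMultiple g

  truncated-inChain : ∀ g → InSomeInfiniteChain (truncatedSemigroup g)
  truncated-inChain g =
    truncatedSemigroup
    , (((λ _ → _) , λ {x} _ → proj₁ (proj₁ (proj₂ (truncated-conductor 0))) x z≤n)
      , truncated-parent)
    , g , (λ x∈ → x∈) , (λ x∈ → x∈)

-- Uniqueness in each genus.

truncated-unique :
  ∀ {m} (pr : Prime m) Λ → IsMultiplicity Λ m → InSomeInfiniteChain Λ →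
  carrier (truncatedSemigroup m {{prime⇒nonTrivial pr}} (genus Λ)) ≐ carrier Λ
truncated-unique {m} pr Λ multiplicity inChain
  with inChain⇒truncated pr Λ multiplicity inChain
... | b , Λ⊆ , ⊆Λ =
  -- Both sets are truncated for the same `m` with equally many gaps, so they agree even if `b`
  -- differs from `nonMultiple (genus Λ)`.
  ⊆Λ ∘ truncated-cardinality⇒⊆ gaps Λ-gaps , truncated-cardinality⇒⊆ Λ-gaps gaps ∘ Λ⊆
  where
  gaps   = truncated-gaps m {{prime⇒nonTrivial pr}} (genus Λ)
  Λ-gaps = cardinality-∁-resp-≐ (Λ⊆ , ⊆Λ) (proj₂ (finiteComplement Λ))

theorem5p3 : ∀ (m : ℕ) → Prime m → ∀ (g : ℕ) → g ≥ m ∸ 1 → i[ g , m ]≡ 1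
theorem5p3 m pr g g≥ = enumeration⇒cardinality numericalSemigroupSetoid
  (λ _ → truncatedSemigroup m g)
  (λ _ → refl , truncated-multiplicity m g≥ , truncated-inChain m g)
  (λ { {zero} {zero} _ → refl })
  (λ { {Λ} (refl , multiplicity , inChain) →
       zero , truncated-unique pr Λ multiplicity inChain })
  where instance _ = prime⇒nonTrivial pr
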